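{- For every integer $n$, the sequence $\{d_n^k\}_{0\le k\le n}$ is $2$-log-concave; that is, for all integers $n\ge 4$ and $2\le k\le n-2$, $$\left((d_n^k)^2-d_n^{k-1}d_n^{k+1}\right)^2-\left((d_n^{k-1})^2-d_n^{k-2}d_n^{k}\right)\left((d_n^{k+1})^2-d_n^{k}d_n^{k+2}\right)\ge 0.$$
   Context: Euler's difference table $(e_n^k)_{0\le k\le n}$ (for integers $n\ge 0$) is defined by $e_n^n=n!$ for $n\ge 0$ and $e_n^{k-1}=e_n^k-e_{n-1}^{k-1}$ for $1\le k\le n$. Define $d_n^k=e_n^k/k!$ for $0\le k\le n$. For a sequence $\{a_k\}$ put $b_k=a_k^2-a_{k-1}a_{k+1}$; $2$-log-concavity refers to log-concavity of the sequence $\{b_k\}$, i.e. $b_k^2\ge b_{k-1}b_{k+1}$. For the finite sequence $\{d_n^k\}_{0\le k\le n}$ this is understood only at those indices where every entry appearing lies in the range $0,\dots,n$, which is exactly the displayed inequality for $n\ge 4$ and $2\le k\le n-2$ (no zero-padding of the sequence outside $0\le k\le n$ is used). -}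

module Defs where

open import Data.Nat.Base as ℕ using (ℕ; zero; suc; _∸_; _≤_; _!)
open import Data.Nat.Properties using (n∸n≡0; +-∸-assoc; _!≢0)
open import Data.Integer.Base as ℤ using (ℤ; +_)
open import Data.Rational.Base as ℚ using (ℚ)
open import Relation.Binary.PropositionalEquality using (_≡_; cong)

-- eulerDiff j k is e_{k+j}^k: recursing on the distance j from the diagonal,
-- e_{k+j+1}^k = e_{k+j+1}^{k+1} - e_{k+j}^k.
eulerDiff : ℕ → ℕ → ℤ
eulerDiff zero    k = + (k !)
eulerDiff (suc j) k = eulerDiff j (suc k) ℤ.- eulerDiff j k

-- e n k is e_n^k, meaningful only for k ≤ n; it is determined there by
-- e-diagonal and e-recurrence.
e : ℕ → ℕ → ℤ
e n k = eulerDiff (n ∸ k) k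

e-diagonal : ∀ n → e n n ≡ + (n !)
e-diagonal n = cong (λ j → eulerDiff j n) (n∸n≡0 n)

-- The defining recurrence e_n^{k-1} = e_n^k - e_{n-1}^{k-1} for 1 ≤ k ≤ n,
-- with n and k shifted down by one.
e-recurrence : ∀ {n k} → k ≤ n → e (suc n) k ≡ e (suc n) (suc k) ℤ.- e n k
e-recurrence {k = k} k≤n = cong (λ j → eulerDiff j k) (+-∸-assoc 1 k≤n)

d : ℕ → ℕ → ℚ
d n k = (e n k ℚ./ (k !)) {{k !≢0}}

infix 8 _²

_² : ℚ → ℚ
x ² = x ℚ.* x

{-# OPTIONS --safe #-}
module Submission where

-- The numbers a_k = d_n^k are naturals.  Fix k, write f = k² + k + 1 and
-- b_k = a_k² - a_{k-1} a_{k+1}.  It suffices that b_{k+1} ≥ 0, f b_{k+1} ≤ b_k and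
-- b_{k-1} ≤ f b_k, because then b_{k-1} b_{k+1} ≤ f b_k b_{k+1} ≤ b_k².
-- A three-term recurrence in k expresses all five entries through two of them, and these
-- two are nonnegative combinations of numbers r, u ≥ 0 in terms of which each of the three
-- inequalities is a quadratic form in r and u whose coefficients are polynomials in k - 2
-- and n - k - 2 without negative coefficients.

open import Defs
open import Data.Nat.Base using (ℕ; _∸_) renaming (_+_ to _+ℕ_; _≤_ to _≤ℕ_)
open import Data.Integer.Base as ℤ using (+_; _⊖_)
open import Data.Integer.Properties as ℤₚ using ()
open import Data.Nat.Base as ℕ using (suc; zero; s≤s; _!)
open import Data.Nat.Properties as ℕₚ using (_!≢0)
open import Data.Nat.Tactic.RingSolver using (solve-∀)
open import Data.Product.Base using (∃₂; _×_; _,_)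
open import Data.Rational.Base as ℚ using (*≤*)
open import Data.Rational.Literals using (fromℤ)
open import Data.Rational.Properties as ℚₚ using ()
open import Data.Rational.Unnormalised.Base as ℚᵘ using ()
open import Relation.Binary.PropositionalEquality
  using (_≡_; refl; sym; trans; cong; cong₂; subst; subst₂; module ≡-Reasoning)

-- Subtraction-free recurrences for the normalised table.

module _ where
  open import Data.Nat.Base using (_+_; _*_; _≤_)

  -- D j k is d_{k+j}^k.
  D : ℕ → ℕ → ℕ
  D zero          k = 1
  D (suc zero)    k = k
  D (suc (suc j)) k = suc j * suc k * D j (suc k) + k * D (suc j) k

  -- The defining recurrence of `e` divided by `k !`. It ties the table to `D`, whose own recursion
  -- avoids subtraction and so stays in the naturals.
  D-difference : ∀ j k → D (suc j) k + D j k ≡ suc k * D j (suc k)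
  D-difference zero          k = trans (ℕₚ.+-comm k 1) (sym (ℕₚ.*-identityʳ (suc k)))
  D-difference (suc zero)    k = square k
    where
    square : ∀ k → 1 * (1 + k) * 1 + k * k + k ≡ (1 + k) * (1 + k)
    square = solve-∀
  -- Two induction hypotheses enter: at `suc j` with the same `k` for `x + y`, and at `j` with
  -- `suc k` for `a + b`.
  D-difference (suc (suc j)) k = begin
    ((2 + j) * (1 + k) * a + k * x) + ((1 + j) * (1 + k) * b + k * y)
      ≡⟨ regroup j k a b x y ⟩
    (2 + j) * (1 + k) * a + (1 + j) * (1 + k) * b + k * (x + y)
      ≡⟨ cong (λ m → (2 + j) * (1 + k) * a + (1 + j) * (1 + k) * b + k * m) (D-difference (suc j) k) ⟩
    (2 + j) * (1 + k) * a + (1 + j) * (1 + k) * b + k * ((1 + k) * a)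
      ≡⟨ factor j k a b ⟩
    (1 + k) * ((1 + j) * (a + b) + (1 + k) * a)
      ≡⟨ cong (λ m → (1 + k) * ((1 + j) * m + (1 + k) * a)) (D-difference j (suc k)) ⟩
    (1 + k) * ((1 + j) * ((2 + k) * c) + (1 + k) * a)
      ≡⟨ cong (λ m → (1 + k) * (m + (1 + k) * a)) (sym (ℕₚ.*-assoc (1 + j) (2 + k) c)) ⟩
    (1 + k) * ((1 + j) * (2 + k) * c + (1 + k) * a) ∎
    where
    open ≡-Reasoning
    a = D (suc j) (suc k)
    b = D j (suc k)
    c = D j (suc (suc k))
    x = D (suc (suc j)) k
    y = D (suc j) k
    regroup : ∀ j k a b x y →
      ((2 + j) * (1 + k) * a + k * x) + ((1 + j) * (1 + k) * b + k * y)
      ≡ (2 + j) * (1 + k) * a + (1 + j) * (1 + k) * b + k * (x + y)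
    regroup = solve-∀
    factor : ∀ j k a b →
      (2 + j) * (1 + k) * a + (1 + j) * (1 + k) * b + k * ((1 + k) * a)
      ≡ (1 + k) * ((1 + j) * (a + b) + (1 + k) * a)
    factor = solve-∀

  D-pascal : ∀ j k → D (suc j) (suc k) ≡ D (suc j) k + suc j * D j (suc k)
  D-pascal zero    k = ℕₚ.+-comm 1 k
  D-pascal (suc j) k = begin
    (1 + j) * (2 + k) * c + (1 + k) * a
      ≡⟨ cong (_+ (1 + k) * a) (ℕₚ.*-assoc (1 + j) (2 + k) c) ⟩
    (1 + j) * ((2 + k) * c) + (1 + k) * a
      ≡⟨ cong (λ m → (1 + j) * m + (1 + k) * a) (D-difference j (suc k)) ⟨
    (1 + j) * (a + b) + (1 + k) * a
      -- Only `k` copies of `a` go to the induction hypothesis; the other `2 + j` already form the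
      -- last summand of the goal.
      ≡⟨ split j k a b ⟩
    (1 + j) * b + (2 + j) * a + k * a
      ≡⟨ cong (λ m → (1 + j) * b + (2 + j) * a + k * m) (D-pascal j k) ⟩
    (1 + j) * b + (2 + j) * a + k * (y + (1 + j) * b)
      ≡⟨ regroup j k a b y ⟩
    (1 + j) * (1 + k) * b + k * y + (2 + j) * a ∎
    where
    open ≡-Reasoning
    a = D (suc j) (suc k)
    b = D j (suc k)
    c = D j (suc (suc k))
    y = D (suc j) k
    split : ∀ j k a b → (1 + j) * (a + b) + (1 + k) * a ≡ (1 + j) * b + (2 + j) * a + k * a
    split = solve-∀
    regroup : ∀ j k a b y →
      (1 + j) * b + (2 + j) * a + k * (y + (1 + j) * b)
      ≡ (1 + j) * (1 + k) * b + k * y + (2 + j) * a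
    regroup = solve-∀

  -- Unfolding the left side of `D-pascal (suc j) k` by the definition of `D` leaves only entries of
  -- row k + j + 2.
  D-three-term : ∀ j k →
    D (suc (suc j)) k + (2 + j) * D (suc j) (suc k)
    ≡ (1 + j) * (2 + k) * D j (suc (suc k)) + (1 + k) * D (suc j) (suc k)
  D-three-term j k = sym (D-pascal (suc j) k)

  -- For i > 0, r is the entry `D (i - 1) (suc k)`. With t = `D i k` and q = `D i (suc k)`, the
  -- nonnegativity of r and u records t ≤ q and k (q - t) ≤ i t.
  D-parameters : ∀ i k → ∃₂ λ r u → D i k ≡ k * r + u × D i (suc k) ≡ D i k + i * r
  D-parameters zero    k = 0 , 1 , sym (cong (_+ 1) (ℕₚ.*-zeroʳ k)) , refl
  D-parameters (suc i) k = D i (suc k) , u i , eq i , D-pascal i k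
    where
    u : ℕ → ℕ
    u zero    = 0
    u (suc i) = suc i * D i (suc k)
    eq : ∀ i → D (suc i) k ≡ k * D i (suc k) + u i
    eq zero    = sym (trans (ℕₚ.+-identityʳ (k * 1)) (ℕₚ.*-identityʳ k))
    eq (suc i) = begin
      (1 + i) * (1 + k) * b + k * y        ≡⟨ regroup i k b y ⟩
      k * (y + (1 + i) * b) + (1 + i) * b  ≡⟨ cong (λ m → k * m + (1 + i) * b) (D-pascal i k) ⟨
      k * D (suc i) (suc k) + (1 + i) * b  ∎
      where
      open ≡-Reasoning
      b = D i (suc k)
      y = D (suc i) k
      regroup : ∀ i k b y → (1 + i) * (1 + k) * b + k * y ≡ k * (y + (1 + i) * b) + (1 + i) * b
      regroup = solve-∀

  -- Quadratic forms behind the three inequalities.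

  -- In the next lemmas k = 2 + a, n = k + 2 + i, and v, w, x, y, z stand for
  -- d_n^{k-2}, …, d_n^{k+2}, while q is d_{n-1}^{k+1}.  To avoid subtraction, v, w and z
  -- enter only through their recurrences; on using the one for w, the inequality
  -- b_{k-1} ≤ f b_k becomes linear in w.
  minor-identity : ∀ a i r u →
    let k = 2 + a
        q = (k + i) * r + u
        y = (1 + k + i) * q + i * r
        x = ((1 + i) * (1 + k) + k * k) * q + k * i * r
    in
    (2 + k) * (y * y) ≡ x * (y + q) +
      ( (32 + i * (70 + i * (49 + i * (12 + i))) + a * (56 + i * (83 + i * (34 + i * 4))
         + a * (36 + i * (32 + i * 6) + a * (10 + i * 4 + a)))) * r * r
      + (32 + i * (45 + i * (17 + i * 2)) + a * (40 + i * (33 + i * 6)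
         + a * (16 + i * 6 + a * 2))) * r * u
      + (8 + i * (5 + i) + a * (6 + i * 2 + a)) * u * u)
  minor-identity = solve-∀

  -- Since y + q = (2 + k) z and w + (3 + i) x = h y + k x, the quadratic form equals (2 + k) (b_k -
  -- f b_{k+1}).
  lower-identity : ∀ a i r u →
    let k = 2 + a
        f = 1 + k + k * k
        h = (2 + i) * (1 + k)
        q = (k + i) * r + u
        y = (1 + k + i) * q + i * r
        x = ((1 + i) * (1 + k) + k * k) * q + k * i * r
    in
    (2 + k) * (x * x + (3 + i) * x * y) + f * (x * (y + q))
      ≡ (2 + k) * (f * (y * y) + (h * y + k * x) * y) +
      ( (32 + i * (62 + i * (61 + i * (32 + i * 5)))
         + a * (40 + i * (99 + i * (94 + i * (29 + i * 2)))
         + a * (16 + i * (62 + i * (42 + i * 6)) + a * (2 + i * (18 + i * 6)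
         + a * (i * 2))))) * r * r
      + (32 + i * (89 + i * (73 + i * 14)) + a * (24 + i * (97 + i * (53 + i * 5))
         + a * (4 + i * (37 + i * 10) + a * (i * 5)))) * r * u
      + (8 + i * (29 + i * 9) + a * (2 + i * (17 + i * 3) + a * (i * 3))) * u * u)
  lower-identity = solve-∀

  -- The quadratic form equals f b_k - b_{k-1}: the recurrences for v and w reduce that difference
  -- to (f + (3 + i) k) x² - w s with s = h y + f y + 2 x, and w = h y + k x - (3 + i) x.
  upper-identity : ∀ a i r u →
    let k = 2 + a
        f = 1 + k + k * k
        h = (2 + i) * (1 + k)
        q = (k + i) * r + u
        y = (1 + k + i) * q + i * r
        x = ((1 + i) * (1 + k) + k * k) * q + k * i * r
    in
    (f + (3 + i) * k) * (x * x) + (3 + i) * x * (h * y + f * y + 2 * x)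
      ≡ (h * y + k * x) * (h * y + f * y + 2 * x) +
      ( (216 + i * (430 + i * (257 + i * 41)) + a * (520 + i * (869 + i * (420 + i * 53))
         + a * (558 + i * (725 + i * (246 + i * 19)) + a * (340 + i * (311 + i * (63 + i * 2))
         + a * (122 + i * (68 + i * 6) + a * (24 + i * 6 + a * 2)))))) * r * r
      + (216 + i * (357 + i * (183 + i * (37 + i * 3)))
         + a * (412 + i * (508 + i * (165 + i * (18 + i)))
         + a * (352 + i * (288 + i * (50 + i * 2)) + a * (164 + i * (77 + i * 5)
         + a * (40 + i * 8 + a * 4))))) * r * u
      + (54 + i * (71 + i * (28 + i * 3)) + a * (76 + i * (55 + i * (12 + i))
         + a * (50 + i * (17 + i) + a * (16 + i * 2 + a * 2)))) * u * u)
  upper-identity = solve-∀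

  ≤-from-≡-+ : ∀ {m n d} → n ≡ m + d → m ≤ n
  ≤-from-≡-+ {m} {d = d} refl = ℕₚ.m≤m+n m d

  -- The entries are variables tied by equations, so that matching on `refl` leaves the polynomial
  -- identities, whose remainders are naturals.
  window-bounds : ∀ a i r u q y x →
    let k = 2 + a
        f = 1 + k + k * k
        h = (2 + i) * (1 + k)
    in
    q ≡ (k + i) * r + u →
    y ≡ (1 + k + i) * q + i * r →
    x ≡ ((1 + i) * (1 + k) + k * k) * q + k * i * r →
    (x * (y + q) ≤ (2 + k) * (y * y)) ×
    ((2 + k) * (f * (y * y) + (h * y + k * x) * y)
      ≤ (2 + k) * (x * x + (3 + i) * x * y) + f * (x * (y + q))) ×
    ((h * y + k * x) * (h * y + f * y + 2 * x)
      ≤ (f + (3 + i) * k) * (x * x) + (3 + i) * x * (h * y + f * y + 2 * x))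
  window-bounds a i r u _ _ _ refl refl refl =
    ≤-from-≡-+ (minor-identity a i r u) ,
    ≤-from-≡-+ (lower-identity a i r u) ,
    ≤-from-≡-+ (upper-identity a i r u)

  minor-nonneg : ∀ k q x y z →
    y + q ≡ (2 + k) * z →
    x * (y + q) ≤ (2 + k) * (y * y) →
    x * z ≤ y * y
  minor-nonneg k q x y z z-rec bound = ℕₚ.*-cancelˡ-≤ (2 + k) (begin
    (2 + k) * (x * z)  ≡⟨ swap k x z ⟩
    x * ((2 + k) * z)  ≡⟨ cong (x *_) z-rec ⟨
    x * (y + q)        ≤⟨ bound ⟩
    (2 + k) * (y * y)  ∎)
    where
    open ℕₚ.≤-Reasoning
    swap : ∀ k x z → (2 + k) * (x * z) ≡ x * ((2 + k) * z)
    swap = solve-∀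

  -- This is f b_{k+1} ≤ b_k with the subtracted terms moved across. Adding c x y makes w occur only
  -- as w + c x, which the recurrence knows.
  minor-ratio-lower : ∀ k f c m q w x y z →
    y + q ≡ (2 + k) * z →
    w + c * x ≡ m →
    (2 + k) * (f * (y * y) + m * y) ≤ (2 + k) * (x * x + c * x * y) + f * (x * (y + q)) →
    f * (y * y) + w * y ≤ x * x + f * (x * z)
  minor-ratio-lower k f c _ q w x y z z-rec refl bound =
    ℕₚ.+-cancelʳ-≤ (c * x * y) _ _ (ℕₚ.*-cancelˡ-≤ (2 + k) (begin
      (2 + k) * (f * (y * y) + w * y + c * x * y)                  ≡⟨ expand k f c w x y ⟩
      (2 + k) * (f * (y * y) + (w + c * x) * y)                    ≤⟨ bound ⟩
      (2 + k) * (x * x + c * x * y) + f * (x * (y + q))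
        ≡⟨ cong (λ s → (2 + k) * (x * x + c * x * y) + f * (x * s)) z-rec ⟩
      (2 + k) * (x * x + c * x * y) + f * (x * ((2 + k) * z))      ≡⟨ collect k f c x y z ⟩
      (2 + k) * (x * x + f * (x * z) + c * x * y)                  ∎))
    where
    open ℕₚ.≤-Reasoning
    expand : ∀ k f c w x y →
      (2 + k) * (f * (y * y) + w * y + c * x * y) ≡ (2 + k) * (f * (y * y) + (w + c * x) * y)
    expand = solve-∀
    collect : ∀ k f c x y z →
      (2 + k) * (x * x + c * x * y) + f * (x * ((2 + k) * z))
      ≡ (2 + k) * (x * x + f * (x * z) + c * x * y)
    collect = solve-∀

  -- This is b_{k-1} ≤ f b_k. Adding (1 + c) w x serves both recurrences: it completes w to w + c x
  -- on the left and v to v + (1 + c) w on the right.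
  minor-ratio-upper : ∀ a c f h v w x y →
    let k = 2 + a in
    w + c * x ≡ h * y + k * x →
    v + (1 + c) * w ≡ c * k * x + (1 + a) * w →
    (h * y + k * x) * (h * y + f * y + 2 * x)
      ≤ (f + c * k) * (x * x) + c * x * (h * y + f * y + 2 * x) →
    w * w + f * (w * y) ≤ f * (x * x) + v * x
  minor-ratio-upper a c f h v w x y w-rec v-rec bound =
    ℕₚ.+-cancelʳ-≤ ((1 + c) * w * x) _ _ (begin
      w * w + f * (w * y) + (1 + c) * w * x
        ≡⟨ collect c f w x y ⟩
      w * (w + c * x) + f * (w * y) + w * x
        ≡⟨ cong (λ m → w * m + f * (w * y) + w * x) w-rec ⟩
      w * (h * y + (2 + a) * x) + f * (w * y) + w * x
        ≡⟨ split a f h w x y ⟩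
      w * (h * y + f * y + 2 * x) + (1 + a) * w * x
        ≤⟨ ℕₚ.+-monoˡ-≤ ((1 + a) * w * x) linear ⟩
      (f + c * (2 + a)) * (x * x) + (1 + a) * w * x
        ≡⟨ factor a c f w x ⟩
      f * (x * x) + (c * (2 + a) * x + (1 + a) * w) * x
        ≡⟨ cong (λ m → f * (x * x) + m * x) v-rec ⟨
      f * (x * x) + (v + (1 + c) * w) * x
        ≡⟨ expand c f v w x ⟩
      f * (x * x) + v * x + (1 + c) * w * x ∎)
    where
    open ℕₚ.≤-Reasoning
    s = h * y + f * y + 2 * x
    -- As `s` is free of w, adding c x s eliminates w.
    linear : w * s ≤ (f + c * (2 + a)) * (x * x)
    linear = ℕₚ.+-cancelʳ-≤ (c * x * s) _ _ (begin
      w * s + c * x * s                            ≡⟨ ℕₚ.*-distribʳ-+ s w (c * x) ⟨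
      (w + c * x) * s                              ≡⟨ cong (_* s) w-rec ⟩
      (h * y + (2 + a) * x) * s                    ≤⟨ bound ⟩
      (f + c * (2 + a)) * (x * x) + c * x * s      ∎)
    collect : ∀ c f w x y →
      w * w + f * (w * y) + (1 + c) * w * x ≡ w * (w + c * x) + f * (w * y) + w * x
    collect = solve-∀
    split : ∀ a f h w x y →
      w * (h * y + (2 + a) * x) + f * (w * y) + w * x
      ≡ w * (h * y + f * y + 2 * x) + (1 + a) * w * x
    split = solve-∀
    factor : ∀ a c f w x →
      (f + c * (2 + a)) * (x * x) + (1 + a) * w * x
      ≡ f * (x * x) + (c * (2 + a) * x + (1 + a) * w) * x
    factor = solve-∀
    expand : ∀ c f v w x →
      f * (x * x) + (v + (1 + c) * w) * x ≡ f * (x * x) + v * x + (1 + c) * w * x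
    expand = solve-∀

  D-bounds : ∀ a i →
    let k = 2 + a
        f = 1 + k + k * k
        v = D (4 + i) a
        w = D (3 + i) (1 + a)
        x = D (2 + i) k
        y = D (1 + i) (1 + k)
        z = D i (2 + k)
    in
    (x * z ≤ y * y) ×
    (f * (y * y) + w * y ≤ x * x + f * (x * z)) ×
    (w * w + f * (w * y) ≤ f * (x * x) + v * x)
  D-bounds a i =
    let k = 2 + a
        f = 1 + k + k * k
        h = (2 + i) * (1 + k)
        v = D (4 + i) a
        w = D (3 + i) (1 + a)
        x = D (2 + i) k
        y = D (1 + i) (1 + k)
        z = D i (2 + k)
        q = D i (1 + k)
        r , u , t≡ , q≡ = D-parameters i k
        p≡ = difference-step i k r q≡
        concave , low , high = window-bounds a i r u q y x
          (trans q≡ (trans (cong (_+ i * r) t≡) (q-regroup k i r u)))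
          (trans (D-pascal i k) (trans (cong (_+ (1 + i) * q) p≡) (y-regroup k i q r)))
          (trans (cong (λ p → (1 + i) * (1 + k) * q + k * p) p≡) (x-regroup k i q r))
    in
    minor-nonneg k q x y z (D-difference i (1 + k)) concave ,
    minor-ratio-lower k f (3 + i) (h * y + k * x) q w x y z
      (D-difference i (1 + k)) (D-three-term (1 + i) (1 + a)) low ,
    minor-ratio-upper a (3 + i) f h v w x y
      (D-three-term (1 + i) (1 + a)) (D-three-term (2 + i) a) high
    where
    difference-step : ∀ i k r → D i (1 + k) ≡ D i k + i * r → D (1 + i) k ≡ k * D i (1 + k) + i * r
    difference-step i k r q≡ = ℕₚ.+-cancelʳ-≡ (D i k) _ _ (begin
      D (1 + i) k + D i k                  ≡⟨ D-difference i k ⟩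
      D i (1 + k) + k * D i (1 + k)        ≡⟨ cong (_+ k * D i (1 + k)) q≡ ⟩
      D i k + i * r + k * D i (1 + k)      ≡⟨ rotate (D i k) (i * r) (k * D i (1 + k)) ⟩
      k * D i (1 + k) + i * r + D i k      ∎)
      where
      open ≡-Reasoning
      rotate : ∀ l m n → l + m + n ≡ n + m + l
      rotate = solve-∀
    q-regroup : ∀ k i r u → k * r + u + i * r ≡ (k + i) * r + u
    q-regroup = solve-∀
    y-regroup : ∀ k i q r → k * q + i * r + (1 + i) * q ≡ (1 + k + i) * q + i * r
    y-regroup = solve-∀
    x-regroup : ∀ k i q r →
      (1 + i) * (1 + k) * q + k * (k * q + i * r) ≡ ((1 + i) * (1 + k) + k * k) * q + k * i * r
    x-regroup = solve-∀

  -- Integer differences of naturals.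

  ⊖-mono-cross : ∀ m n p q → m + q ≤ p + n → m ⊖ n ℤ.≤ p ⊖ q
  ⊖-mono-cross m n p q m+q≤p+n = begin
    m ⊖ n              ≡⟨ ℤₚ.+-cancelˡ-⊖ q m n ⟨
    (q + m) ⊖ (q + n)
      ≤⟨ ℤₚ.⊖-monoˡ-≤ (q + n) (subst₂ _≤_ (ℕₚ.+-comm m q) (ℕₚ.+-comm p n) m+q≤p+n) ⟩
    (n + p) ⊖ (q + n)  ≡⟨ cong ((n + p) ⊖_) (ℕₚ.+-comm q n) ⟩
    (n + p) ⊖ (n + q)  ≡⟨ ℤₚ.+-cancelˡ-⊖ n p q ⟩
    p ⊖ q              ∎
    where open ℤₚ.≤-Reasoning

  *-distribˡ-⊖ : ∀ f m n → + f ℤ.* (m ⊖ n) ≡ (f * m) ⊖ (f * n)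
  *-distribˡ-⊖ f m n = begin
    + f ℤ.* (m ⊖ n)                      ≡⟨ cong (+ f ℤ.*_) (ℤₚ.m-n≡m⊖n m n) ⟨
    + f ℤ.* (+ m ℤ.- + n)                ≡⟨ ℤₚ.*-distribˡ-+ (+ f) (+ m) (ℤ.- + n) ⟩
    + f ℤ.* + m ℤ.+ + f ℤ.* (ℤ.- + n)    ≡⟨ cong (ℤ._+_ (+ f ℤ.* + m)) (ℤₚ.neg-distribʳ-* (+ f) (+ n)) ⟨
    + f ℤ.* + m ℤ.- + f ℤ.* + n          ≡⟨ cong₂ ℤ._-_ (ℤₚ.pos-* f m) (ℤₚ.pos-* f n) ⟨
    + (f * m) ℤ.- + (f * n)              ≡⟨ ℤₚ.m-n≡m⊖n (f * m) (f * n) ⟩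
    (f * m) ⊖ (f * n)                    ∎
    where open ≡-Reasoning

-- From integers to rationals.

open import Data.Rational.Base using (0ℚ; _*_; _-_; _≥_)

square-≥-product : ∀ f {i j l} → ℤ.0ℤ ℤ.≤ l → + f ℤ.* l ℤ.≤ j → i ℤ.≤ + f ℤ.* j →
  ℤ.0ℤ ℤ.≤ j ℤ.* j ℤ.- i ℤ.* l
square-≥-product f {i} {j} {l} 0≤l fl≤j i≤fj = ℤₚ.i≤j⇒0≤j-i (begin
  i ℤ.* l            ≤⟨ ℤₚ.*-monoʳ-≤-nonNeg l i≤fj ⟩
  + f ℤ.* j ℤ.* l    ≡⟨ cong (ℤ._* l) (ℤₚ.*-comm (+ f) j) ⟩
  j ℤ.* + f ℤ.* l    ≡⟨ ℤₚ.*-assoc j (+ f) l ⟩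
  j ℤ.* (+ f ℤ.* l)  ≤⟨ ℤₚ.*-monoˡ-≤-nonNeg j fl≤j ⟩
  j ℤ.* j            ∎)
  where
  open ℤₚ.≤-Reasoning
  instance
    l-nonNeg : ℤ.NonNegative l
    l-nonNeg = ℤ.nonNegative 0≤l
    -- The sign of `j` is inherited from `l` through 0 ≤ f l ≤ j.
    j-nonNeg : ℤ.NonNegative j
    j-nonNeg = ℤ.nonNegative (begin
      ℤ.0ℤ            ≡⟨ ℤₚ.*-zeroʳ (+ f) ⟨
      + f ℤ.* ℤ.0ℤ    ≤⟨ ℤₚ.*-monoˡ-≤-nonNeg (+ f) 0≤l ⟩
      + f ℤ.* l       ≤⟨ fl≤j ⟩
      j               ∎)

fromℤ-* : ∀ i j → fromℤ i * fromℤ j ≡ fromℤ (i ℤ.* j)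
fromℤ-* i j = ℚₚ.↥p/↧p≡p (fromℤ (i ℤ.* j))

-- Negation of rationals is defined by cases on the numerator, hence the split.
fromℤ-neg : ∀ i → ℚ.- fromℤ i ≡ fromℤ (ℤ.- i)
fromℤ-neg (+ zero)     = refl
fromℤ-neg ℤ.+[1+ n ]   = refl
fromℤ-neg ℤ.-[1+ n ]   = refl

fromℤ-+ : ∀ i j → fromℤ i ℚ.+ fromℤ j ≡ fromℤ (i ℤ.+ j)
fromℤ-+ i j = trans
  (cong (ℚ._/ 1) (cong₂ ℤ._+_ (ℤₚ.*-identityʳ i) (ℤₚ.*-identityʳ j)))
  (ℚₚ.↥p/↧p≡p (fromℤ (i ℤ.+ j)))

fromℤ-- : ∀ i j → fromℤ i - fromℤ j ≡ fromℤ (i ℤ.- j)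
fromℤ-- i j = trans (cong (ℚ._+_ (fromℤ i)) (fromℤ-neg j)) (fromℤ-+ i (ℤ.- j))

fromℤ-minor : ∀ i j k l → fromℤ i * fromℤ j - fromℤ k * fromℤ l ≡ fromℤ (i ℤ.* j ℤ.- k ℤ.* l)
fromℤ-minor i j k l =
  trans (cong₂ _-_ (fromℤ-* i j) (fromℤ-* k l)) (fromℤ-- (i ℤ.* j) (k ℤ.* l))

fromℕ-minor : ∀ m n p q →
  fromℤ (+ m) * fromℤ (+ n) - fromℤ (+ p) * fromℤ (+ q) ≡ fromℤ ((m ℕ.* n) ⊖ (p ℕ.* q))
fromℕ-minor m n p q = begin
  fromℤ (+ m) * fromℤ (+ n) - fromℤ (+ p) * fromℤ (+ q)
    ≡⟨ fromℤ-minor (+ m) (+ n) (+ p) (+ q) ⟩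
  fromℤ (+ m ℤ.* + n ℤ.- + p ℤ.* + q)
    ≡⟨ cong fromℤ (cong₂ ℤ._-_ (ℤₚ.pos-* m n) (ℤₚ.pos-* p q)) ⟨
  fromℤ (+ (m ℕ.* n) ℤ.- + (p ℕ.* q))
    ≡⟨ cong fromℤ (ℤₚ.m-n≡m⊖n (m ℕ.* n) (p ℕ.* q)) ⟩
  fromℤ ((m ℕ.* n) ⊖ (p ℕ.* q)) ∎
  where open ≡-Reasoning

fromℤ-nonNegative : ∀ {i} → ℤ.0ℤ ℤ.≤ i → fromℤ i ≥ 0ℚ
fromℤ-nonNegative {i} 0≤i = *≤* (subst (ℤ.0ℤ ℤ.≤_) (sym (ℤₚ.*-identityʳ i)) 0≤i)

-- Unnormalised rationals are compared by cross multiplication, so no gcd has to be computed.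
cancel-/ : ∀ c n .{{_ : ℕ.NonZero c}} → (+ (c ℕ.* n)) ℚ./ c ≡ fromℤ (+ n)
cancel-/ c@(suc c-1) n = trans
  (ℚₚ.fromℚᵘ-cong {ℚᵘ.mkℚᵘ (+ (c ℕ.* n)) c-1} {ℚᵘ.mkℚᵘ (+ n) 0} (ℚᵘ.*≡* (begin
    + (c ℕ.* n) ℤ.* + 1  ≡⟨ ℤₚ.*-identityʳ (+ (c ℕ.* n)) ⟩
    + (c ℕ.* n)          ≡⟨ cong +_ (ℕₚ.*-comm c n) ⟩
    + (n ℕ.* c)          ≡⟨ ℤₚ.pos-* n c ⟩
    + n ℤ.* + c          ∎)))
  (ℚₚ.↥p/↧p≡p (fromℤ (+ n)))
  where open ≡-Reasoning

-- `D-difference` times `k !` turns the minuend into a sum that contains the subtrahend.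
eulerDiff≡!*D : ∀ j k → eulerDiff j k ≡ + (k ! ℕ.* D j k)
eulerDiff≡!*D zero    k = cong +_ (sym (ℕₚ.*-identityʳ (k !)))
eulerDiff≡!*D (suc j) k = begin
  eulerDiff j (suc k) ℤ.- eulerDiff j k
    ≡⟨ cong₂ ℤ._-_ (eulerDiff≡!*D j (suc k)) (eulerDiff≡!*D j k) ⟩
  + ((suc k) ! ℕ.* D j (suc k)) ℤ.- + (k ! ℕ.* D j k)
    ≡⟨ ℤₚ.m-n≡m⊖n ((suc k) ! ℕ.* D j (suc k)) (k ! ℕ.* D j k) ⟩
  ((suc k) ! ℕ.* D j (suc k)) ⊖ (k ! ℕ.* D j k)
    ≡⟨ cong (_⊖ (k ! ℕ.* D j k)) (begin
      (suc k) ! ℕ.* D j (suc k)                    ≡⟨ cong (ℕ._* D j (suc k)) (ℕₚ.*-comm (suc k) (k !)) ⟩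
      k ! ℕ.* suc k ℕ.* D j (suc k)                ≡⟨ ℕₚ.*-assoc (k !) (suc k) (D j (suc k)) ⟩
      k ! ℕ.* (suc k ℕ.* D j (suc k))              ≡⟨ cong (k ! ℕ.*_) (D-difference j k) ⟨
      k ! ℕ.* (D (suc j) k ℕ.+ D j k)              ≡⟨ cong (k ! ℕ.*_) (ℕₚ.+-comm (D (suc j) k) (D j k)) ⟩
      k ! ℕ.* (D j k ℕ.+ D (suc j) k)              ≡⟨ ℕₚ.*-distribˡ-+ (k !) (D j k) (D (suc j) k) ⟩
      k ! ℕ.* D j k ℕ.+ k ! ℕ.* D (suc j) k        ∎) ⟩
  (k ! ℕ.* D j k ℕ.+ k ! ℕ.* D (suc j) k) ⊖ (k ! ℕ.* D j k)
    -- The added 0 gives both sides a common summand; once it cancels, `m ⊖ 0` computes to `+ m`.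
    ≡⟨ cong ((k ! ℕ.* D j k ℕ.+ k ! ℕ.* D (suc j) k) ⊖_) (ℕₚ.+-identityʳ (k ! ℕ.* D j k)) ⟨
  (k ! ℕ.* D j k ℕ.+ k ! ℕ.* D (suc j) k) ⊖ (k ! ℕ.* D j k ℕ.+ 0)
    ≡⟨ ℤₚ.+-cancelˡ-⊖ (k ! ℕ.* D j k) (k ! ℕ.* D (suc j) k) 0 ⟩
  + (k ! ℕ.* D (suc j) k) ∎
  where open ≡-Reasoning

-- The distance comes with an equation because `n ∸ k` need not compute to the form on which `D`
-- recurses.
d≡D : ∀ j n k → n ∸ k ≡ j → d n k ≡ fromℤ (+ D j k)
d≡D j n k refl = trans
  (cong (λ i → (i ℚ./ (k !)) {{k !≢0}}) (eulerDiff≡!*D j k))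
  (cancel-/ (k !) (D j k) {{k !≢0}})

-- Assembly of the inequality.

2-log-concave-from-ratios : ∀ f {v w x y z} →
  x ℕ.* z ≤ℕ y ℕ.* y →
  f ℕ.* (y ℕ.* y) +ℕ w ℕ.* y ≤ℕ x ℕ.* x +ℕ f ℕ.* (x ℕ.* z) →
  w ℕ.* w +ℕ f ℕ.* (w ℕ.* y) ≤ℕ f ℕ.* (x ℕ.* x) +ℕ v ℕ.* x →
  (fromℤ (+ x) ² - fromℤ (+ w) * fromℤ (+ y)) ²
    - (fromℤ (+ w) ² - fromℤ (+ v) * fromℤ (+ x)) * (fromℤ (+ y) ² - fromℤ (+ x) * fromℤ (+ z))
  ≥ 0ℚ
2-log-concave-from-ratios f {v} {w} {x} {y} {z} concave low high = subst (_≥ 0ℚ)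
  (sym (trans
    (cong₂ _-_ (cong₂ _*_ b≡ b≡) (cong₂ _*_ (fromℕ-minor w w v x) (fromℕ-minor y y x z)))
    (fromℤ-minor b b b₋ b₊)))
  (fromℤ-nonNegative (square-≥-product f
    -- Here 0 ≤ b₊ is obtained as `0 ⊖ 0` ≤ b₊.
    (⊖-mono-cross 0 0 (y ℕ.* y) (x ℕ.* z)
      (subst (x ℕ.* z ≤ℕ_) (sym (ℕₚ.+-identityʳ (y ℕ.* y))) concave))
    (subst (ℤ._≤ b) (sym (*-distribˡ-⊖ f (y ℕ.* y) (x ℕ.* z)))
      (⊖-mono-cross (f ℕ.* (y ℕ.* y)) (f ℕ.* (x ℕ.* z)) (x ℕ.* x) (w ℕ.* y) low))
    (subst (b₋ ℤ.≤_) (sym (*-distribˡ-⊖ f (x ℕ.* x) (w ℕ.* y)))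
      (⊖-mono-cross (w ℕ.* w) (v ℕ.* x) (f ℕ.* (x ℕ.* x)) (f ℕ.* (w ℕ.* y)) high))))
  where
  b₋ = (w ℕ.* w) ⊖ (v ℕ.* x)
  b  = (x ℕ.* x) ⊖ (w ℕ.* y)
  b₊ = (y ℕ.* y) ⊖ (x ℕ.* z)
  b≡ = fromℕ-minor x x w y

2-log-concave-at : ∀ a i {v w x y z} →
  v ≡ fromℤ (+ D (4 +ℕ i) a) →
  w ≡ fromℤ (+ D (3 +ℕ i) (1 +ℕ a)) →
  x ≡ fromℤ (+ D (2 +ℕ i) (2 +ℕ a)) →
  y ≡ fromℤ (+ D (1 +ℕ i) (3 +ℕ a)) →
  z ≡ fromℤ (+ D i (4 +ℕ a)) →
  (x ² - w * y) ² - (w ² - v * x) * (y ² - x * z) ≥ 0ℚ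
2-log-concave-at a i refl refl refl refl refl =
  let concave , low , high = D-bounds a i
  -- The explicit argument is f = 1 + k + k² at k = 2 + a.
  in 2-log-concave-from-ratios (3 +ℕ a +ℕ (2 +ℕ a) ℕ.* (2 +ℕ a))
    {D (4 +ℕ i) a} {D (3 +ℕ i) (1 +ℕ a)} {D (2 +ℕ i) (2 +ℕ a)} {D (1 +ℕ i) (3 +ℕ a)} {D i (4 +ℕ a)}
    concave low high

theorem2p3 : ∀ (n k : ℕ) → 4 ≤ℕ n → 2 ≤ℕ k → k ≤ℕ n ∸ 2 →
    (d n k ² - d n (k ∸ 1) * d n (k +ℕ 1)) ²
    - (d n (k ∸ 1) ² - d n (k ∸ 2) * d n k)
    * (d n (k +ℕ 1) ² - d n k * d n (k +ℕ 2))
    ≥ 0ℚ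
theorem2p3 n (suc zero) _ (s≤s ()) _
theorem2p3 (suc zero) k (s≤s ()) _ _
theorem2p3 (suc (suc n-2)) (suc (suc a)) _ _ k≤n-2
  -- The witness `i` is n - k - 2, the distance of the entry d_n^{k+2} from the diagonal.
  with i , refl ← ℕₚ.m≤n⇒∃[o]m+o≡n k≤n-2 =
  2-log-concave-at a i
    (d≡D (4 +ℕ i) n a (distance 4))
    (d≡D (3 +ℕ i) n (1 +ℕ a) (distance 3))
    (d≡D (2 +ℕ i) n (2 +ℕ a) (distance 2))
    -- Addition is stuck on `a` in `k +ℕ 1` and `k +ℕ 2`, so the constant is commuted to the front.
    (trans (cong (λ m → d n (2 +ℕ m)) (ℕₚ.+-comm a 1)) (d≡D (1 +ℕ i) n (3 +ℕ a) (distance 1)))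
    (trans (cong (λ m → d n (2 +ℕ m)) (ℕₚ.+-comm a 2)) (d≡D i n (4 +ℕ a) (distance 0)))
  where
  n = 4 +ℕ (a +ℕ i)
  distance : ∀ m → m +ℕ (a +ℕ i) ∸ a ≡ m +ℕ i
  distance m = trans (ℕₚ.+-∸-assoc m (ℕₚ.m≤m+n a i)) (cong (m +ℕ_) (ℕₚ.m+n∸m≡n a i))
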